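{- For $k\geq 0$ let $\mathcal{E}_k(x)=\sum_{n=1}^{\infty}e(n)^{k}x^n$ (with $0^0=1$). Then $\mathcal{E}_0(x)=\frac{x}{1-x}$, and for every $k\geq 1$, $$\mathcal{E}_k(x)-\mathcal{E}_k(x^2)-\frac{x^2+1}{x}\,\mathcal{E}_k(x^4)=\sum_{j=0}^{k-1}C(k,j)\left(\mathcal{E}_j(x^2)+\frac{x^2+1}{x}\,\mathcal{E}_j(x^4)\right),$$ where $C(k,j)=\binom{k}{j}$.
   Context: The Stern polynomials $B_n(t)\in\mathbb{Z}[t]$ are defined by $B_0(t)=0$, $B_1(t)=1$, and for $n\geq 1$: $B_{2n}(t)=tB_n(t)$, $B_{2n+1}(t)=B_n(t)+B_{n+1}(t)$. For $n\geq1$ let $e(n)=\deg B_n(t)$. -}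

module Defs where

open import Algebra.Bundles.Raw using (RawMonoid)
import Algebra.Definitions.RawMonoid as RawMonoidDefinitions
open import Algebra.Properties.CommutativeMonoid.Sum using (sum)
open import Data.Bool.Base using (if_then_else_)
open import Data.Fin.Base using (toℕ)
open import Data.Integer.Base using (ℤ; +_; 0ℤ; 1ℤ)
import Data.Integer.Base as ℤ
import Data.Integer.Properties as ℤ
open import Data.List.Base using (List; []; _∷_)
open import Data.List.Relation.Unary.All using (All; []; _∷_; all?)
open import Data.Nat.Base using (ℕ; zero; suc; _∸_; _^_; _<_; s<s⁻¹; ⌊_/2⌋; ⌈_/2⌉)
import Data.Nat.Base as ℕ
open import Data.Nat.Divisibility using (_∣?_)
open import Data.Nat.DivMod using (_/_)
open import Data.Nat.Induction using (<-wellFounded)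
open import Data.Nat.Properties using (⌊n/2⌋<n; ⌈n/2⌉<n; +-suc; +-identityʳ; n≡⌊n+n/2⌋; n≡⌈n+n/2⌉)
open import Data.Parity.Base using (0ℙ; 1ℙ)
open import Data.Sum.Base using ([_,_]′)
open import Induction.WellFounded using (Acc; acc)
open import Level using (0ℓ)
open import Relation.Binary.PropositionalEquality using (_≡_; _≢_; refl; sym; trans; cong; cong₂)
open import Relation.Nullary using (yes; no; does; contradiction)

-- Coefficient lists, constant term first; trailing zeros are allowed, so
-- distinct lists may denote the same polynomial.
Poly : Set
Poly = List ℤ

coeff : Poly → ℕ → ℤ
coeff []      _       = 0ℤ
coeff (a ∷ _) zero    = a
coeff (_ ∷ p) (suc n) = coeff p n

infixl 6 _+ₚ_

_+ₚ_ : Poly → Poly → Poly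
[]      +ₚ q       = q
(a ∷ p) +ₚ []      = a ∷ p
(a ∷ p) +ₚ (b ∷ q) = (a ℤ.+ b) ∷ (p +ₚ q)

t·_ : Poly → Poly
t· p = 0ℤ ∷ p

-- The largest index of a nonzero coefficient; by convention 0 for the
-- zero polynomial.
deg : Poly → ℕ
deg []      = 0
deg (_ ∷ p) = if does (all? (ℤ._≟ 0ℤ) p) then 0 else suc (deg p)

private
  coeff-zero : ∀ {p} → All (_≡ 0ℤ) p → ∀ n → coeff p n ≡ 0ℤ
  coeff-zero []       _       = refl
  coeff-zero (z ∷ _)  zero    = z
  coeff-zero (_ ∷ zs) (suc n) = coeff-zero zs n

deg-vanish : ∀ p {n} → deg p < n → coeff p n ≡ 0ℤ
deg-vanish []      _ = refl
deg-vanish (_ ∷ p) {suc n} d<n with all? (ℤ._≟ 0ℤ) p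
... | yes zs = coeff-zero zs n
... | no  _  = deg-vanish p (s<s⁻¹ d<n)

deg-leading : ∀ p {n} → coeff p n ≢ 0ℤ → coeff p (deg p) ≢ 0ℤ
deg-leading []      n≢0 = n≢0
deg-leading (_ ∷ p) {n} n≢0 with all? (ℤ._≟ 0ℤ) p
deg-leading (_ ∷ p) {zero}  n≢0 | yes _  = n≢0
deg-leading (_ ∷ p) {suc n} n≢0 | yes zs = contradiction (coeff-zero zs n) n≢0
deg-leading (_ ∷ p) {n}     n≢0 | no ¬zs = λ lead≡0 → ¬zs (allZero p lead≡0)
  where
  allZero : ∀ q → coeff q (deg q) ≡ 0ℤ → All (_≡ 0ℤ) q
  allZero []      _ = []
  allZero (_ ∷ q) l≡0 with all? (ℤ._≟ 0ℤ) q
  ... | yes zs  = l≡0 ∷ zs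
  ... | no ¬zs′ = contradiction (allZero q l≡0) ¬zs′

private
  sternAcc : ∀ n → Acc _<_ n → Poly
  sternAcc 0 _ = []
  sternAcc 1 _ = 1ℤ ∷ []
  sternAcc n@(suc (suc m)) (acc rs) with ℕ.parity n
  ... | 0ℙ = t· sternAcc ⌊ n /2⌋ (rs (⌊n/2⌋<n (suc m)))
  ... | 1ℙ = sternAcc ⌊ n /2⌋ (rs (⌊n/2⌋<n (suc m))) +ₚ sternAcc ⌈ n /2⌉ (rs (⌈n/2⌉<n m))

-- Well-founded recursion hides the defining recurrence, which is
-- recovered by stern-even and stern-odd.
stern : ℕ → Poly
stern n = sternAcc n (<-wellFounded n)

private
  sternAcc-irr : ∀ n (a b : Acc _<_ n) → sternAcc n a ≡ sternAcc n b
  sternAcc-irr 0 _ _ = refl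
  sternAcc-irr 1 _ _ = refl
  sternAcc-irr n@(suc (suc m)) (acc rs) (acc rs′) with ℕ.parity n
  ... | 0ℙ = cong t·_ (sternAcc-irr ⌊ n /2⌋ _ _)
  ... | 1ℙ = cong₂ _+ₚ_ (sternAcc-irr ⌊ n /2⌋ _ _) (sternAcc-irr ⌈ n /2⌉ _ _)

  sternAcc-step-even : ∀ m (a : Acc _<_ (2 ℕ.+ m)) → ℕ.parity m ≡ 0ℙ →
                       sternAcc (2 ℕ.+ m) a ≡ t· stern (suc ⌊ m /2⌋)
  sternAcc-step-even m (acc rs) eq with ℕ.parity m | eq
  ... | 0ℙ | refl = cong t·_ (sternAcc-irr (suc ⌊ m /2⌋) _ _)

  sternAcc-step-odd : ∀ m (a : Acc _<_ (2 ℕ.+ m)) → ℕ.parity m ≡ 1ℙ →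
                      sternAcc (2 ℕ.+ m) a ≡ stern (suc ⌊ m /2⌋) +ₚ stern (suc ⌈ m /2⌉)
  sternAcc-step-odd m (acc rs) eq with ℕ.parity m | eq
  ... | 1ℙ | refl = cong₂ _+ₚ_ (sternAcc-irr (suc ⌊ m /2⌋) _ _) (sternAcc-irr (suc ⌈ m /2⌉) _ _)

  parity-2n : ∀ n → ℕ.parity (n ℕ.+ n) ≡ 0ℙ
  parity-2n zero = refl
  parity-2n (suc n) rewrite +-suc n n = parity-2n n

  parity-1+2n : ∀ n → ℕ.parity (suc (n ℕ.+ n)) ≡ 1ℙ
  parity-1+2n zero = refl
  parity-1+2n (suc n) rewrite +-suc n n = parity-1+2n n

stern-even : ∀ n .{{_ : ℕ.NonZero n}} → stern (2 ℕ.* n) ≡ t· stern n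
stern-even (suc n) rewrite +-identityʳ n | +-suc n n =
  trans (sternAcc-step-even (n ℕ.+ n) _ (parity-2n n))
        (cong (λ i → t· stern (suc i)) (sym (n≡⌊n+n/2⌋ n)))

stern-odd : ∀ n .{{_ : ℕ.NonZero n}} → stern (1 ℕ.+ 2 ℕ.* n) ≡ stern n +ₚ stern (1 ℕ.+ n)
stern-odd (suc n) rewrite +-identityʳ n | +-suc n n =
  trans (sternAcc-step-odd (suc (n ℕ.+ n)) _ (parity-1+2n n))
        (cong₂ (λ i j → stern (suc i) +ₚ stern (2 ℕ.+ j)) (sym (n≡⌈n+n/2⌉ n)) (sym (n≡⌊n+n/2⌋ n)))

e : ℕ → ℕ
e n = deg (stern n)

-- Coefficient sequences: f denotes Σₙ f(n) xⁿ in ℤ[[x]].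
PowerSeries : Set
PowerSeries = ℕ → ℤ

infix  4 _≈ₛ_
infixl 6 _+ₛ_ _-ₛ_
infixl 7 _*ₛ_
infix  8 _[x^_]

_≈ₛ_ : PowerSeries → PowerSeries → Set
f ≈ₛ g = ∀ n → f n ≡ g n

const : ℤ → PowerSeries
const c zero    = c
const c (suc _) = 0ℤ

0ₛ 1ₛ x : PowerSeries
0ₛ = const 0ℤ
1ₛ = const 1ℤ
x 1 = 1ℤ
x _ = 0ℤ

_+ₛ_ _-ₛ_ _*ₛ_ : PowerSeries → PowerSeries → PowerSeries
(f +ₛ g) n = f n ℤ.+ g n
(f -ₛ g) n = f n ℤ.- g n
(f *ₛ g) n = sum ℤ.+-0-commutativeMonoid {suc n} (λ i → f (toℕ i) ℤ.* g (n ∸ toℕ i))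

-- The substitution f(xᵐ).
_[x^_] : PowerSeries → (m : ℕ) .{{_ : ℕ.NonZero m}} → PowerSeries
(f [x^ m ]) n = if does (m ∣? n) then f (n / m) else 0ℤ

record NonZero (f : PowerSeries) : Set where
  constructor nonZero
  field
    index   : ℕ
    coeff≢0 : f index ≢ 0ℤ

instance
  1-nonZero : NonZero 1ₛ
  1-nonZero = nonZero 0 λ ()

  x-nonZero : NonZero x
  x-nonZero = nonZero 1 λ ()

  1-x-nonZero : NonZero (1ₛ -ₛ x)
  1-x-nonZero = nonZero 0 λ ()

private
  tail : PowerSeries → PowerSeries
  tail f n = f (suc n)

  *-tailˡ : ∀ f g → f 0 ≡ 0ℤ → ∀ n → (f *ₛ g) (suc n) ≡ (tail f *ₛ g) n
  *-tailˡ f g f₀≡0 n rewrite f₀≡0 = ℤ.+-identityˡ _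

  *-tailʳ : ∀ f g → g 0 ≡ 0ℤ → ∀ n → (f *ₛ g) (suc n) ≡ (f *ₛ tail g) n
  *-tailʳ f g g₀≡0 zero rewrite g₀≡0 | ℤ.*-zeroʳ (f 1) = refl
  *-tailʳ f g g₀≡0 (suc n) = cong (λ s → f 0 ℤ.* g (2 ℕ.+ n) ℤ.+ s) (*-tailʳ (tail f) g g₀≡0 n)

  nonZeroʳ : ∀ f g → f 0 ≢ 0ℤ → ∀ n → g n ≢ 0ℤ → NonZero (f *ₛ g)
  nonZeroʳ f g f₀≢0 n gₙ≢0 with g 0 ℤ.≟ 0ℤ
  nonZeroʳ f g f₀≢0 n gₙ≢0 | no g₀≢0 = nonZero 0 λ fg≡0 →
    [ f₀≢0 , g₀≢0 ]′ (ℤ.i*j≡0⇒i≡0∨j≡0 (f 0) (trans (sym (ℤ.+-identityʳ _)) fg≡0))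
  nonZeroʳ f g f₀≢0 zero    gₙ≢0 | yes g₀≡0 = contradiction g₀≡0 gₙ≢0
  nonZeroʳ f g f₀≢0 (suc n) gₙ≢0 | yes g₀≡0 with nonZeroʳ f (tail g) f₀≢0 n gₙ≢0
  ... | nonZero i p = nonZero (suc i) λ q → p (trans (sym (*-tailʳ f g g₀≡0 i)) q)

  nonZeroˡ : ∀ f g → NonZero g → ∀ n → f n ≢ 0ℤ → NonZero (f *ₛ g)
  nonZeroˡ f g (nonZero m gₘ≢0) n fₙ≢0 with f 0 ℤ.≟ 0ℤ
  nonZeroˡ f g (nonZero m gₘ≢0) n fₙ≢0       | no f₀≢0 = nonZeroʳ f g f₀≢0 m gₘ≢0
  nonZeroˡ f g _                zero    fₙ≢0 | yes f₀≡0 = contradiction f₀≡0 fₙ≢0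
  nonZeroˡ f g g≢0              (suc n) fₙ≢0 | yes f₀≡0 with nonZeroˡ (tail f) g g≢0 n fₙ≢0
  ... | nonZero i p = nonZero (suc i) λ q → p (trans (sym (*-tailˡ f g f₀≡0 i)) q)

-- ℤ[[x]] is an integral domain.
*-nonZero : ∀ {f g} → NonZero f → NonZero g → NonZero (f *ₛ g)
*-nonZero {f} {g} (nonZero n fₙ≢0) g≢0 = nonZeroˡ f g g≢0 n fₙ≢0

infix 7.5 _÷_

-- The field of fractions of ℤ[[x]]; it makes sense of x/(1-x) and (x²+1)/x.
record Fraction : Set where
  constructor _÷_
  field
    num       : PowerSeries
    den       : PowerSeries
    {{den≢0}} : NonZero den

open Fraction

infix  4 _≃_
infixl 6 _+_ _-_
infixl 7 _*_

_≃_ : Fraction → Fraction → Set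
p ≃ q = num p *ₛ den q ≈ₛ num q *ₛ den p

_+_ _-_ _*_ : Fraction → Fraction → Fraction
p + q = _÷_ (num p *ₛ den q +ₛ num q *ₛ den p) (den p *ₛ den q) {{*-nonZero (den≢0 p) (den≢0 q)}}
p - q = _÷_ (num p *ₛ den q -ₛ num q *ₛ den p) (den p *ₛ den q) {{*-nonZero (den≢0 p) (den≢0 q)}}
p * q = _÷_ (num p *ₛ num q) (den p *ₛ den q) {{*-nonZero (den≢0 p) (den≢0 q)}}

ι : PowerSeries → Fraction
ι f = f ÷ 1ₛ

+-rawMonoid : RawMonoid 0ℓ 0ℓ
+-rawMonoid = record { Carrier = Fraction ; _≈_ = _≃_ ; _∙_ = _+_ ; ε = ι 0ₛ }

∑< : (k : ℕ) → (ℕ → Fraction) → Fraction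
∑< k a = RawMonoidDefinitions.sum +-rawMonoid {k} (λ j → a (toℕ j))

infixl 5.5 ∑<
syntax ∑< k (λ j → a) = ∑[ j < k ] a

-- ℕ exponentiation satisfies 0 ^ 0 = 1.
ℰ : ℕ → PowerSeries
ℰ k zero      = 0ℤ
ℰ k n@(suc _) = + (e n ^ k)

{-# OPTIONS --safe #-}
-- The degrees satisfy e(2n) = e(n) + 1, e(4n + 1) = e(n) + 1 and
-- e(4n + 3) = e(n + 1) + 1 (for indices ≥ 1), because the Stern polynomials have
-- nonnegative coefficients and consecutive degrees differ by at most 1.
-- Hence at each power of x there is an a such that ℰⱼ(x²) + (x + x⁻¹) ℰⱼ(x⁴) has
-- coefficient aʲ and ℰₖ(x) has coefficient (a + 1)ᵏ, or else both coefficients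
-- vanish for all j ≥ 0 and k ≥ 1; the identity is then the binomial theorem
-- coefficient by coefficient.
module Submission where

open import Defs
open import Algebra.Bundles using (AbelianGroup; CommutativeRing)
import Algebra.Construct.Pointwise as Pointwise
open import Algebra.Consequences.Setoid using (comm∧idˡ⇒id; comm∧distrʳ⇒distr)
import Algebra.Properties.CommutativeSemigroup as CommutativeSemigroupProperties
import Algebra.Properties.CommutativeSemiring.Binomial as BinomialTheorem
import Algebra.Properties.Ring as RingProperties
import Algebra.Properties.Semiring.Exp as Exp
import Algebra.Properties.Semiring.Mult as Mult
import Algebra.Properties.Semiring.Sum as SemiringSum
open import Data.Fin.Base using (Fin; toℕ; fromℕ; inject₁; zero; suc)
open import Data.Fin.Properties using (toℕ-inject₁; toℕ-fromℕ)
open import Data.Integer.Base using (ℤ; +_; 0ℤ; 1ℤ)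
import Data.Integer.Base as ℤ
import Data.Integer.Properties as ℤ
open import Data.List.Base using ([]; _∷_)
open import Data.List.Relation.Unary.All using (All; []; _∷_; all?)
open import Data.Nat.Base using (ℕ; zero; suc; _≤_; _<_; _⊔_; _∸_; _^_; z≤n; s≤s)
import Data.Nat.Base as ℕ
open import Data.Nat.Combinatorics using (_C_; nCn≡1)
open import Data.Nat.Divisibility using (_∣?_; n∣m*n; n∣m⇒m%n≡0)
open import Data.Nat.DivMod using (_%_; m*n/n≡m; [m+kn]%n≡m%n; m<n⇒m%n≡m; _divMod_; result)
open import Data.Nat.Induction using (<-rec)
import Data.Nat.Properties as ℕ
open import Data.Product.Base using (_×_; _,_; proj₁; proj₂; ∃-syntax)
open import Data.Sum.Base using (_⊎_; inj₁; inj₂)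
open import Function.Base using (_∘_)
open import Level using (0ℓ)
import Relation.Binary.Reasoning.Setoid as SetoidReasoning
open import Relation.Binary.PropositionalEquality
  using (_≡_; refl; sym; trans; cong; cong₂; subst; module ≡-Reasoning)
open import Relation.Nullary using (¬_; yes; no; contradiction)

-- Degrees of Stern polynomials

Nonneg : Poly → Set
Nonneg = All (0ℤ ℤ.≤_)

Zero : Poly → Set
Zero = All (_≡ 0ℤ)

+-nonneg : ∀ {p q} → Nonneg p → Nonneg q → Nonneg (p +ₚ q)
+-nonneg []       bs       = bs
+-nonneg (a ∷ as) []       = a ∷ as
+-nonneg (a ∷ as) (b ∷ bs) = ℤ.+-mono-≤ a b ∷ +-nonneg as bs

+-zero : ∀ {p q} → Zero p → Zero q → Zero (p +ₚ q)
+-zero []       bs       = bs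
+-zero (a ∷ as) []       = a ∷ as
+-zero (a ∷ as) (b ∷ bs) = cong₂ ℤ._+_ a b ∷ +-zero as bs

nonneg-i+j≡0⇒i≡0 : ∀ {i j} → 0ℤ ℤ.≤ i → 0ℤ ℤ.≤ j → i ℤ.+ j ≡ 0ℤ → i ≡ 0ℤ
nonneg-i+j≡0⇒i≡0 {+ m} {+ n} _ _ eq = cong +_ (ℕ.m+n≡0⇒m≡0 m (ℤ.+-injective eq))

nonneg-+-zeroˡ : ∀ {p q} → Nonneg p → Nonneg q → Zero (p +ₚ q) → Zero p
nonneg-+-zeroˡ []       bs       zs       = []
nonneg-+-zeroˡ (a ∷ as) []       zs       = zs
nonneg-+-zeroˡ (a ∷ as) (b ∷ bs) (z ∷ zs) = nonneg-i+j≡0⇒i≡0 a b z ∷ nonneg-+-zeroˡ as bs zs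

+ₚ-comm : ∀ p q → p +ₚ q ≡ q +ₚ p
+ₚ-comm []      []      = refl
+ₚ-comm []      (b ∷ q) = refl
+ₚ-comm (a ∷ p) []      = refl
+ₚ-comm (a ∷ p) (b ∷ q) = cong₂ _∷_ (ℤ.+-comm a b) (+ₚ-comm p q)

nonneg-+-zeroʳ : ∀ {p q} → Nonneg p → Nonneg q → Zero (p +ₚ q) → Zero q
nonneg-+-zeroʳ {p} {q} as bs zs = nonneg-+-zeroˡ bs as (subst Zero (+ₚ-comm p q) zs)

deg-zero : ∀ {p} → Zero p → deg p ≡ 0
deg-zero []       = refl
deg-zero {_ ∷ p} (_ ∷ zs) with all? (ℤ._≟ 0ℤ) p
... | yes _  = refl
... | no ¬zs = contradiction zs ¬zs

deg-t· : ∀ {p} → ¬ Zero p → deg (t· p) ≡ suc (deg p)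
deg-t· {p} ¬zs with all? (ℤ._≟ 0ℤ) p
... | yes zs = contradiction zs ¬zs
... | no _   = refl

-- Nonnegative coefficients cannot cancel, so the leading term of larger degree survives in the sum.
-- The cases follow the test in `deg` for whether a tail vanishes.
deg-+ : ∀ {p q} → Nonneg p → Nonneg q → deg (p +ₚ q) ≡ deg p ⊔ deg q
deg-+ []       bs = refl
deg-+ (a ∷ as) [] = sym (ℕ.⊔-identityʳ _)
deg-+ {_ ∷ p} {_ ∷ q} (a ∷ as) (b ∷ bs)
  with all? (ℤ._≟ 0ℤ) (p +ₚ q) | all? (ℤ._≟ 0ℤ) p | all? (ℤ._≟ 0ℤ) q
... | yes zs | yes _   | yes _   = refl
... | yes zs | no p≢0  | _       = contradiction (nonneg-+-zeroˡ as bs zs) p≢0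
... | yes zs | yes _   | no q≢0  = contradiction (nonneg-+-zeroʳ as bs zs) q≢0
... | no ¬zs | yes p≡0 | yes q≡0 = contradiction (+-zero p≡0 q≡0) ¬zs
... | no _   | yes p≡0 | no _    = cong suc (trans (deg-+ as bs) (cong (_⊔ deg q) (deg-zero p≡0)))
... | no _   | no _    | yes q≡0 = cong suc (begin
        deg (p +ₚ q)   ≡⟨ deg-+ as bs ⟩
        deg p ⊔ deg q  ≡⟨ cong (deg p ⊔_) (deg-zero q≡0) ⟩
        deg p ⊔ 0      ≡⟨ ℕ.⊔-identityʳ _ ⟩
        deg p          ∎)
  where open ≡-Reasoning
... | no _   | no _    | no _    = cong suc (deg-+ as bs)

-- Induction along the Stern recurrence, for properties of positive indices.
halving-induction : ∀ (P : ℕ → Set) → P 1 →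
                    (∀ n → P (suc n) → P (2 ℕ.* suc n)) →
                    (∀ n → P (suc n) → P (2 ℕ.+ n) → P (1 ℕ.+ 2 ℕ.* suc n)) →
                    ∀ n → P (suc n)
halving-induction P P1 even odd = <-rec (P ∘ suc) step
  where
  step : ∀ n → (∀ {m} → m < n → P (suc m)) → P (suc n)
  step n rec with n divMod 2
  step _ rec | result zero          zero       refl = P1
  -- The division is applied to the predecessor of the index, so remainder 0 means an odd index and
  -- remainder 1 an even one.
  step _ rec | result (suc q)       zero       refl =
    subst (P ∘ suc) (ℕ.*-comm 2 (suc q))
      (odd q (rec (s≤s (ℕ.m≤n⇒m≤1+n (ℕ.m≤m*n q 2)))) (rec (s≤s (s≤s (ℕ.m≤m*n q 2)))))
  step _ rec | result q             (suc zero) refl =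
    subst P (ℕ.*-comm 2 (suc q)) (even q (rec (s≤s (ℕ.m≤m*n q 2))))

-- The two properties are proved together: at odd indices it is nonnegativity that keeps the sum
-- from cancelling to zero.
stern-nonneg-nonzero : ∀ n → Nonneg (stern (suc n)) × ¬ Zero (stern (suc n))
stern-nonneg-nonzero = halving-induction (NonnegNonzero ∘ stern)
  (ℤ.+≤+ z≤n ∷ [] , λ { (() ∷ _) })
  (λ n (pos , ≢0) → subst NonnegNonzero (sym (stern-even (suc n)))
    (ℤ.≤-refl ∷ pos , λ { (_ ∷ zs) → ≢0 zs }))
  (λ n (pos , ≢0) (pos′ , _) → subst NonnegNonzero (sym (stern-odd (suc n)))
    (+-nonneg pos pos′ , ≢0 ∘ nonneg-+-zeroˡ pos pos′))
  where
  NonnegNonzero : Poly → Set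
  NonnegNonzero p = Nonneg p × ¬ Zero p

e[2n]≡1+e[n] : ∀ n .{{_ : ℕ.NonZero n}} → e (2 ℕ.* n) ≡ 1 ℕ.+ e n
e[2n]≡1+e[n] n@(suc m) =
  trans (cong deg (stern-even n)) (deg-t· (proj₂ (stern-nonneg-nonzero m)))

e[1+2n]≡e[n]⊔e[1+n] : ∀ n .{{_ : ℕ.NonZero n}} → e (1 ℕ.+ 2 ℕ.* n) ≡ e n ⊔ e (1 ℕ.+ n)
e[1+2n]≡e[n]⊔e[1+n] n@(suc m) =
  trans (cong deg (stern-odd n))
        (deg-+ (proj₁ (stern-nonneg-nonzero m)) (proj₁ (stern-nonneg-nonzero (suc m))))

e-2+2n : ∀ n → e (2 ℕ.+ 2 ℕ.* n) ≡ 1 ℕ.+ e (suc n)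
e-2+2n n = trans (cong e (sym (ℕ.*-suc 2 n))) (e[2n]≡1+e[n] (suc n))

-- The pair (2n, 2n+1) compares `1 + e n` with `e n ⊔ e (1 + n)`, and (2n+1, 2n+2) compares that
-- maximum with `1 + e (1 + n)`. The first case uses the bound on `e (1 + n)` by `e n`, the second
-- the reverse bound.
e-close : ∀ n → e (2 ℕ.+ n) ≤ 1 ℕ.+ e (suc n) × e (suc n) ≤ 1 ℕ.+ e (2 ℕ.+ n)
e-close = halving-induction Close (s≤s z≤n , z≤n) even odd
  where
  Close : ℕ → Set
  Close n = e (suc n) ≤ 1 ℕ.+ e n × e n ≤ 1 ℕ.+ e (suc n)

  even : ∀ n → Close (suc n) → Close (2 ℕ.* suc n)
  even n (up , _) rewrite e[2n]≡1+e[n] (suc n) {{_}} | e[1+2n]≡e[n]⊔e[1+n] (suc n) {{_}} =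
    ℕ.⊔-lub (ℕ.m≤n+m _ 2) (ℕ.m≤n⇒m≤1+n up) , s≤s (ℕ.m≤m⊔n _ _)

  odd : ∀ n → Close (suc n) → Close (2 ℕ.+ n) → Close (1 ℕ.+ 2 ℕ.* suc n)
  odd n (_ , down) _ rewrite e-2+2n (suc n) | e[1+2n]≡e[n]⊔e[1+n] (suc n) {{_}} =
    s≤s (ℕ.m≤n⊔m _ _) , ℕ.⊔-lub (ℕ.m≤n⇒m≤1+n down) (ℕ.m≤n+m _ 2)

e[n*2]≡1+e[n] : ∀ n .{{_ : ℕ.NonZero n}} → e (n ℕ.* 2) ≡ 1 ℕ.+ e n
e[n*2]≡1+e[n] n = trans (cong e (ℕ.*-comm n 2)) (e[2n]≡1+e[n] n)

n*4≡2*[2*n] : ∀ n → n ℕ.* 4 ≡ 2 ℕ.* (2 ℕ.* n)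
n*4≡2*[2*n] n = trans (ℕ.*-comm n 4) (ℕ.*-assoc 2 2 n)

-- Two uses of the recurrence give the maximum of `1 + e n`, `e n` and `e (1 + n)`; by `e-close` the
-- first dominates.
e[1+n*4]≡1+e[n] : ∀ n .{{_ : ℕ.NonZero n}} → e (1 ℕ.+ n ℕ.* 4) ≡ 1 ℕ.+ e n
e[1+n*4]≡1+e[n] n@(suc m) = begin
  e (1 ℕ.+ n ℕ.* 4)                  ≡⟨ cong (e ∘ suc) (n*4≡2*[2*n] n) ⟩
  e (1 ℕ.+ 2 ℕ.* (2 ℕ.* n))          ≡⟨ e[1+2n]≡e[n]⊔e[1+n] (2 ℕ.* n) ⟩
  e (2 ℕ.* n) ⊔ e (1 ℕ.+ 2 ℕ.* n)    ≡⟨ cong₂ _⊔_ (e[2n]≡1+e[n] n) (e[1+2n]≡e[n]⊔e[1+n] n) ⟩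
  (1 ℕ.+ e n) ⊔ (e n ⊔ e (1 ℕ.+ n))  ≡⟨ ℕ.m≥n⇒m⊔n≡m (ℕ.⊔-lub (ℕ.n≤1+n _) (proj₁ (e-close m))) ⟩
  1 ℕ.+ e n                          ∎
  where open ≡-Reasoning

e[3+n*4]≡1+e[1+n] : ∀ n → e (3 ℕ.+ n ℕ.* 4) ≡ 1 ℕ.+ e (suc n)
-- Index 3 is computed directly, since `e-close` compares degrees at positive indices.
e[3+n*4]≡1+e[1+n] zero      = refl
e[3+n*4]≡1+e[1+n] n@(suc m) = begin
  e (3 ℕ.+ n ℕ.* 4)                        ≡⟨ cong (e ∘ (3 ℕ.+_)) (n*4≡2*[2*n] n) ⟩
  e (3 ℕ.+ 2 ℕ.* (2 ℕ.* n))                ≡⟨ cong (e ∘ suc) (ℕ.*-suc 2 (2 ℕ.* n)) ⟨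
  e (1 ℕ.+ 2 ℕ.* (1 ℕ.+ 2 ℕ.* n))          ≡⟨ e[1+2n]≡e[n]⊔e[1+n] (1 ℕ.+ 2 ℕ.* n) ⟩
  e (1 ℕ.+ 2 ℕ.* n) ⊔ e (2 ℕ.+ 2 ℕ.* n)    ≡⟨ cong₂ _⊔_ (e[1+2n]≡e[n]⊔e[1+n] n) (e-2+2n n) ⟩
  (e n ⊔ e (1 ℕ.+ n)) ⊔ (1 ℕ.+ e (1 ℕ.+ n)) ≡⟨ ℕ.m≤n⇒m⊔n≡n (ℕ.⊔-lub (proj₂ (e-close m)) (ℕ.n≤1+n _)) ⟩
  1 ℕ.+ e (1 ℕ.+ n)                        ∎
  where open ≡-Reasoning

-- The ring of power series

-- The coefficient `(f *ₛ g) (suc n)` unfolds definitionally to `f 0 * g (suc n)` plus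
-- `(tail f *ₛ g) n`, which drives the inductions on products.
tail : PowerSeries → PowerSeries
tail f n = f (suc n)

*ₛ-cong : ∀ {f f′ g g′} → f ≈ₛ f′ → g ≈ₛ g′ → f *ₛ g ≈ₛ f′ *ₛ g′
*ₛ-cong f≈ g≈ zero    = cong₂ (λ a b → a ℤ.* b ℤ.+ 0ℤ) (f≈ 0) (g≈ 0)
*ₛ-cong f≈ g≈ (suc n) =
  cong₂ ℤ._+_ (cong₂ ℤ._*_ (f≈ 0) (g≈ (suc n))) (*ₛ-cong (f≈ ∘ suc) g≈ n)

-- The definitional unfolding splits off the first term of the convolution; this splits off the last
-- one, and commutativity matches the two.
*ₛ-suc-last : ∀ f g n → (f *ₛ g) (suc n) ≡ f (suc n) ℤ.* g 0 ℤ.+ (f *ₛ tail g) n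
*ₛ-suc-last f g zero = begin
  f 0 ℤ.* g 1 ℤ.+ (f 1 ℤ.* g 0 ℤ.+ 0ℤ)  ≡⟨ x∙yz≈y∙xz (f 0 ℤ.* g 1) (f 1 ℤ.* g 0) 0ℤ ⟩
  f 1 ℤ.* g 0 ℤ.+ (f 0 ℤ.* g 1 ℤ.+ 0ℤ)  ∎
  where
  open ≡-Reasoning
  open CommutativeSemigroupProperties ℤ.+-commutativeSemigroup
*ₛ-suc-last f g (suc n) = begin
  f 0 ℤ.* g (2 ℕ.+ n) ℤ.+ (tail f *ₛ g) (suc n)
    ≡⟨ cong (λ s → f 0 ℤ.* g (2 ℕ.+ n) ℤ.+ s) (*ₛ-suc-last (tail f) g n) ⟩
  f 0 ℤ.* g (2 ℕ.+ n) ℤ.+ (f (2 ℕ.+ n) ℤ.* g 0 ℤ.+ (tail f *ₛ tail g) n)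
    ≡⟨ x∙yz≈y∙xz (f 0 ℤ.* g (2 ℕ.+ n)) (f (2 ℕ.+ n) ℤ.* g 0) ((tail f *ₛ tail g) n) ⟩
  f (2 ℕ.+ n) ℤ.* g 0 ℤ.+ (f 0 ℤ.* g (2 ℕ.+ n) ℤ.+ (tail f *ₛ tail g) n)
    ∎
  where
  open ≡-Reasoning
  open CommutativeSemigroupProperties ℤ.+-commutativeSemigroup

*ₛ-comm : ∀ f g → f *ₛ g ≈ₛ g *ₛ f
*ₛ-comm f g zero    = cong (ℤ._+ 0ℤ) (ℤ.*-comm (f 0) (g 0))
*ₛ-comm f g (suc n) = begin
  f 0 ℤ.* g (suc n) ℤ.+ (tail f *ₛ g) n  ≡⟨ cong₂ ℤ._+_ (ℤ.*-comm (f 0) (g (suc n))) (*ₛ-comm (tail f) g n) ⟩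
  g (suc n) ℤ.* f 0 ℤ.+ (g *ₛ tail f) n  ≡⟨ *ₛ-suc-last g f n ⟨
  (g *ₛ f) (suc n)                       ∎
  where open ≡-Reasoning

*ₛ-distribʳ-+ₛ : ∀ h f g → (f +ₛ g) *ₛ h ≈ₛ f *ₛ h +ₛ g *ₛ h
*ₛ-distribʳ-+ₛ h f g n = begin
  ((f +ₛ g) *ₛ h) n
    ≡⟨ sum-cong-≗ {suc n} (λ i → ℤ.*-distribʳ-+ (h (n ∸ toℕ i)) (f (toℕ i)) (g (toℕ i))) ⟩
  sum {suc n} (λ i → f (toℕ i) ℤ.* h (n ∸ toℕ i) ℤ.+ g (toℕ i) ℤ.* h (n ∸ toℕ i))
    ≡⟨ ∑-distrib-+ {suc n} (λ i → f (toℕ i) ℤ.* h (n ∸ toℕ i)) (λ i → g (toℕ i) ℤ.* h (n ∸ toℕ i)) ⟩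
  (f *ₛ h +ₛ g *ₛ h) n
    ∎
  where
  open ≡-Reasoning
  open SemiringSum ℤ.+-*-semiring using (sum; sum-cong-≗; ∑-distrib-+)

*ₛ-scaleˡ : ∀ c f g n → ((λ i → c ℤ.* f i) *ₛ g) n ≡ c ℤ.* (f *ₛ g) n
*ₛ-scaleˡ c f g n = begin
  ((λ i → c ℤ.* f i) *ₛ g) n
    ≡⟨ sum-cong-≗ {suc n} (λ i → ℤ.*-assoc c (f (toℕ i)) (g (n ∸ toℕ i))) ⟩
  sum {suc n} (λ i → c ℤ.* (f (toℕ i) ℤ.* g (n ∸ toℕ i)))
    ≡⟨ *-distribˡ-sum {suc n} c (λ i → f (toℕ i) ℤ.* g (n ∸ toℕ i)) ⟨
  c ℤ.* (f *ₛ g) n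
    ∎
  where
  open ≡-Reasoning
  open SemiringSum ℤ.+-*-semiring using (sum; sum-cong-≗; *-distribˡ-sum)

-- Induction on the index with `f` varying: the tail of `f *ₛ g` is `f 0` times `tail g`, plus
-- `tail f *ₛ g`, and the induction hypothesis is applied to `tail f`.
*ₛ-assoc : ∀ f g h → (f *ₛ g) *ₛ h ≈ₛ f *ₛ (g *ₛ h)
*ₛ-assoc f g h zero = begin
  (f 0 ℤ.* g 0 ℤ.+ 0ℤ) ℤ.* h 0 ℤ.+ 0ℤ    ≡⟨ cong (λ a → a ℤ.* h 0 ℤ.+ 0ℤ) (ℤ.+-identityʳ (f 0 ℤ.* g 0)) ⟩
  f 0 ℤ.* g 0 ℤ.* h 0 ℤ.+ 0ℤ             ≡⟨ cong (ℤ._+ 0ℤ) (ℤ.*-assoc (f 0) (g 0) (h 0)) ⟩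
  f 0 ℤ.* (g 0 ℤ.* h 0) ℤ.+ 0ℤ           ≡⟨ cong (λ a → f 0 ℤ.* a ℤ.+ 0ℤ) (ℤ.+-identityʳ (g 0 ℤ.* h 0)) ⟨
  f 0 ℤ.* (g 0 ℤ.* h 0 ℤ.+ 0ℤ) ℤ.+ 0ℤ    ∎
  where open ≡-Reasoning
*ₛ-assoc f g h (suc n) = begin
  (a ℤ.* g 0 ℤ.+ 0ℤ) ℤ.* c ℤ.+ (((λ i → a ℤ.* tail g i) +ₛ tail f *ₛ g) *ₛ h) n
    ≡⟨ cong₂ ℤ._+_ (cong (ℤ._* c) (ℤ.+-identityʳ (a ℤ.* g 0))) (*ₛ-distribʳ-+ₛ h (λ i → a ℤ.* tail g i) (tail f *ₛ g) n) ⟩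
  a ℤ.* g 0 ℤ.* c ℤ.+ (((λ i → a ℤ.* tail g i) *ₛ h) n ℤ.+ ((tail f *ₛ g) *ₛ h) n)
    ≡⟨ cong₂ ℤ._+_ (ℤ.*-assoc a (g 0) c) (cong₂ ℤ._+_ (*ₛ-scaleˡ a (tail g) h n) (*ₛ-assoc (tail f) g h n)) ⟩
  a ℤ.* (g 0 ℤ.* c) ℤ.+ (a ℤ.* (tail g *ₛ h) n ℤ.+ (tail f *ₛ (g *ₛ h)) n)
    ≡⟨ ℤ.+-assoc (a ℤ.* (g 0 ℤ.* c)) _ _ ⟨
  a ℤ.* (g 0 ℤ.* c) ℤ.+ a ℤ.* (tail g *ₛ h) n ℤ.+ (tail f *ₛ (g *ₛ h)) n
    ≡⟨ cong (ℤ._+ (tail f *ₛ (g *ₛ h)) n) (ℤ.*-distribˡ-+ a (g 0 ℤ.* c) _) ⟨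
  a ℤ.* (g 0 ℤ.* c ℤ.+ (tail g *ₛ h) n) ℤ.+ (tail f *ₛ (g *ₛ h)) n
    ∎
  where
  open ≡-Reasoning
  a c : ℤ
  a = f 0
  c = h (suc n)

const-* : ∀ c f n → (const c *ₛ f) n ≡ c ℤ.* f n
const-* c f zero    = ℤ.+-identityʳ _
const-* c f (suc n) = begin
  -- `tail (const c)` is 0 everywhere, hence definitionally its own multiple by `0ℤ`.
  c ℤ.* f (suc n) ℤ.+ (tail (const c) *ₛ f) n  ≡⟨ cong (λ s → c ℤ.* f (suc n) ℤ.+ s) (*ₛ-scaleˡ 0ℤ (tail (const c)) f n) ⟩
  c ℤ.* f (suc n) ℤ.+ 0ℤ                       ≡⟨ ℤ.+-identityʳ _ ⟩
  c ℤ.* f (suc n)                              ∎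
  where open ≡-Reasoning

*ₛ-identityˡ : ∀ f → 1ₛ *ₛ f ≈ₛ f
*ₛ-identityˡ f n = trans (const-* 1ℤ f n) (ℤ.*-identityˡ (f n))

*ₛ-commutativeRing : CommutativeRing 0ℓ 0ℓ
*ₛ-commutativeRing = record
  { _+_ = _+ₛ_
  ; _*_ = _*ₛ_
  ; 1#  = 1ₛ
  ; isCommutativeRing = record
    { isRing = record
      { +-isAbelianGroup = isAbelianGroup
      ; *-cong           = *ₛ-cong
      ; *-assoc          = *ₛ-assoc
      ; *-identity       = comm∧idˡ⇒id setoid *ₛ-comm *ₛ-identityˡ
      ; distrib          = comm∧distrʳ⇒distr setoid ∙-cong *ₛ-comm *ₛ-distribʳ-+ₛ
      }
    ; *-comm = *ₛ-comm
    }
  }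
  where
  open AbelianGroup (Pointwise.abelianGroup ℕ ℤ.+-0-abelianGroup)

module PS = CommutativeRing *ₛ-commutativeRing
open CommutativeSemigroupProperties PS.*-commutativeSemigroup using (xy∙z≈xz∙y)

x*f-suc : ∀ f n → (x *ₛ f) (suc n) ≡ f n
x*f-suc f n = begin
  0ℤ ℤ.+ (tail x *ₛ f) n  ≡⟨ ℤ.+-identityˡ _ ⟩
  (tail x *ₛ f) n         ≡⟨ *ₛ-cong {g = f} tail-x (λ _ → refl) n ⟩
  (1ₛ *ₛ f) n             ≡⟨ *ₛ-identityˡ f n ⟩
  f n                     ∎
  where
  open ≡-Reasoning
  tail-x : tail x ≈ₛ 1ₛ
  tail-x zero    = refl
  tail-x (suc _) = refl

*x-cancelʳ : ∀ f g → f *ₛ x ≈ₛ g *ₛ x → f ≈ₛ g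
*x-cancelʳ f g fx≈gx n = begin
  f n               ≡⟨ x*f-suc f n ⟨
  (x *ₛ f) (suc n)  ≡⟨ *ₛ-comm x f (suc n) ⟩
  (f *ₛ x) (suc n)  ≡⟨ fx≈gx (suc n) ⟩
  (g *ₛ x) (suc n)  ≡⟨ *ₛ-comm g x (suc n) ⟩
  (x *ₛ g) (suc n)  ≡⟨ x*f-suc g n ⟩
  g n               ∎
  where open ≡-Reasoning

[x*x+1]*f : ∀ f n → ((x *ₛ x +ₛ 1ₛ) *ₛ f) n ≡ (x *ₛ (x *ₛ f)) n ℤ.+ f n
[x*x+1]*f f n = trans (*ₛ-distribʳ-+ₛ f (x *ₛ x) 1ₛ n)
                      (cong₂ ℤ._+_ (*ₛ-assoc x x f n) (*ₛ-identityˡ f n))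

-- Fractions with denominator x

open Fraction

infix 4 _≃_÷x

-- p ≃ f ÷ x, unfolded.  All fractions in the theorem are of this form, so
-- transitivity of _≃_ is only needed through x, which is easy to cancel.
-- (A record, so that f can be inferred.)
record _≃_÷x (p : Fraction) (f : PowerSeries) : Set where
  constructor cross
  field
    uncross : num p *ₛ x ≈ₛ f *ₛ den p

-- Serves to pass to a common denominator: `h` is the denominator of the other fraction.
expandʳ : ∀ {p f} h → p ≃ f ÷x → (num p *ₛ h) *ₛ x ≈ₛ f *ₛ (den p *ₛ h)
expandʳ {p} {f} h (cross p≃f) = begin
  (num p *ₛ h) *ₛ x  ≈⟨ xy∙z≈xz∙y (num p) h x ⟩
  (num p *ₛ x) *ₛ h  ≈⟨ *ₛ-cong {g = h} p≃f (λ _ → refl) ⟩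
  (f *ₛ den p) *ₛ h  ≈⟨ *ₛ-assoc f (den p) h ⟩
  f *ₛ (den p *ₛ h)  ∎
  where open SetoidReasoning PS.setoid

expandˡ : ∀ {p f} h → p ≃ f ÷x → (num p *ₛ h) *ₛ x ≈ₛ f *ₛ (h *ₛ den p)
expandˡ {p} {f} h p≃f n =
  trans (expandʳ h p≃f n) (*ₛ-cong {f} (λ _ → refl) (*ₛ-comm (den p) h) n)

-- After multiplication by `x`, both cross products become `f *ₛ (den p *ₛ den q)`.
÷x-unique : ∀ {p q f} → p ≃ f ÷x → q ≃ f ÷x → p ≃ q
÷x-unique {p} {q} p≃f q≃f = *x-cancelʳ (num p *ₛ den q) (num q *ₛ den p)
  λ n → trans (expandʳ (den q) p≃f n) (sym (expandˡ (den p) q≃f n))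

÷x-cong : ∀ {p f g} → f ≈ₛ g → p ≃ f ÷x → p ≃ g ÷x
÷x-cong {p} f≈g (cross p≃f) = cross λ n → trans (p≃f n) (*ₛ-cong {g = den p} f≈g (λ _ → refl) n)

÷x-+ : ∀ {p q f g} → p ≃ f ÷x → q ≃ g ÷x → p + q ≃ f +ₛ g ÷x
÷x-+ {p} {q} {f} {g} p≃f q≃g = cross (begin
  (num p *ₛ den q +ₛ num q *ₛ den p) *ₛ x
    ≈⟨ *ₛ-distribʳ-+ₛ x (num p *ₛ den q) (num q *ₛ den p) ⟩
  num p *ₛ den q *ₛ x +ₛ num q *ₛ den p *ₛ x
    ≈⟨ (λ n → cong₂ ℤ._+_ (expandʳ (den q) p≃f n) (expandˡ (den p) q≃g n)) ⟩
  f *ₛ (den p *ₛ den q) +ₛ g *ₛ (den p *ₛ den q)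
    ≈⟨ *ₛ-distribʳ-+ₛ (den p *ₛ den q) f g ⟨
  (f +ₛ g) *ₛ (den p *ₛ den q)
    ∎)
  where open SetoidReasoning PS.setoid

*ₛ-distribʳ--ₛ : ∀ h f g → (f -ₛ g) *ₛ h ≈ₛ f *ₛ h -ₛ g *ₛ h
*ₛ-distribʳ--ₛ h f g n = begin
  ((f -ₛ g) *ₛ h) n                    ≡⟨ *ₛ-distribʳ-+ₛ h f (PS.- g) n ⟩
  (f *ₛ h) n ℤ.+ ((PS.- g) *ₛ h) n     ≡⟨ cong (λ i → (f *ₛ h) n ℤ.+ i) (-‿distribˡ-* g h n) ⟨
  (f *ₛ h -ₛ g *ₛ h) n                 ∎
  where
  open ≡-Reasoning
  open RingProperties PS.ring using (-‿distribˡ-*)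

÷x-- : ∀ {p q f g} → p ≃ f ÷x → q ≃ g ÷x → p - q ≃ f -ₛ g ÷x
÷x-- {p} {q} {f} {g} p≃f q≃g = cross (begin
  (num p *ₛ den q -ₛ num q *ₛ den p) *ₛ x
    ≈⟨ *ₛ-distribʳ--ₛ x (num p *ₛ den q) (num q *ₛ den p) ⟩
  num p *ₛ den q *ₛ x -ₛ num q *ₛ den p *ₛ x
    ≈⟨ (λ n → cong₂ ℤ._-_ (expandʳ (den q) p≃f n) (expandˡ (den p) q≃g n)) ⟩
  f *ₛ (den p *ₛ den q) -ₛ g *ₛ (den p *ₛ den q)
    ≈⟨ *ₛ-distribʳ--ₛ (den p *ₛ den q) f g ⟨
  (f -ₛ g) *ₛ (den p *ₛ den q)
    ∎)
  where open SetoidReasoning PS.setoid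

÷x-ι : ∀ f → ι f ≃ x *ₛ f ÷x
÷x-ι f = cross λ n → trans (*ₛ-comm f x n) (sym (PS.*-identityʳ (x *ₛ f) n))

÷x-ι* : ∀ c {p f} → p ≃ f ÷x → ι c * p ≃ c *ₛ f ÷x
÷x-ι* c {p} {f} (cross p≃f) = cross (begin
  (c *ₛ num p) *ₛ x           ≈⟨ *ₛ-assoc c (num p) x ⟩
  c *ₛ (num p *ₛ x)           ≈⟨ *ₛ-cong {c} (λ _ → refl) p≃f ⟩
  c *ₛ (f *ₛ den p)           ≈⟨ *ₛ-assoc c f (den p) ⟨
  (c *ₛ f) *ₛ den p           ≈⟨ *ₛ-cong {c *ₛ f} (λ _ → refl) (*ₛ-identityˡ (den p)) ⟨
  (c *ₛ f) *ₛ (1ₛ *ₛ den p)   ∎)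
  where open SetoidReasoning PS.setoid

÷x-*ι : ∀ g f → (g ÷ x) * ι f ≃ g *ₛ f ÷x
÷x-*ι g f = cross (*ₛ-cong {g *ₛ f} (λ _ → refl) (λ n → sym (PS.*-identityʳ x n)))

open SemiringSum ℤ.+-*-semiring using (sum; sum-cong-≗; sum-init-last; sum-replicate-zero)

÷x-∑ : ∀ k (a : ℕ → Fraction) (f : ℕ → PowerSeries) → (∀ j → a j ≃ f j ÷x) → ∑< k a ≃ (λ n → sum {k} (λ j → f (toℕ j) n)) ÷x
÷x-∑ zero    a f a≃f = cross λ n → trans (const-* 0ℤ x n) (sym (PS.zeroˡ 1ₛ n))
÷x-∑ (suc k) a f a≃f = ÷x-+ (a≃f 0) (÷x-∑ k (a ∘ suc) (f ∘ suc) (a≃f ∘ suc))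

-- Coefficients of the functional equation

dilate-multiple : ∀ f m n .{{_ : ℕ.NonZero m}} → (f [x^ m ]) (n ℕ.* m) ≡ f n
dilate-multiple f m n with m ∣? (n ℕ.* m)
... | yes _ = cong f (m*n/n≡m n m)
... | no ∤  = contradiction (n∣m*n n) ∤

dilate-nonmultiple : ∀ f m n r .{{_ : ℕ.NonZero m}} .{{_ : ℕ.NonZero r}} → r < m →
                     (f [x^ m ]) (r ℕ.+ n ℕ.* m) ≡ 0ℤ
dilate-nonmultiple f m n r r<m with m ∣? (r ℕ.+ n ℕ.* m)
... | no _  = refl
... | yes d = contradiction r≡0 (ℕ.≢-nonZero⁻¹ r)
  where
  open ≡-Reasoning
  r≡0 : r ≡ 0
  r≡0 = begin
    r                    ≡⟨ m<n⇒m%n≡m r<m ⟨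
    r % m                ≡⟨ [m+kn]%n≡m%n r n m ⟨
    (r ℕ.+ n ℕ.* m) % m  ≡⟨ n∣m⇒m%n≡0 _ m d ⟩
    0                    ∎

-- x times the summand ℰⱼ(x²) + (x + x⁻¹) ℰⱼ(x⁴) of the right-hand side.
𝒢 : ℕ → PowerSeries
𝒢 j = x *ₛ (ℰ j [x^ 2 ]) +ₛ (x *ₛ x +ₛ 1ₛ) *ₛ (ℰ j [x^ 4 ])

-- The three values come from the factors `x`, `x *ₛ x` and `1ₛ` in `𝒢`; at most one of them is
-- nonzero in each residue class of `n` modulo 4.
𝒢-suc : ∀ j n {a b c} → (ℰ j [x^ 2 ]) n ≡ a → (x *ₛ (ℰ j [x^ 4 ])) n ≡ b →
        (ℰ j [x^ 4 ]) (suc n) ≡ c → 𝒢 j (suc n) ≡ a ℤ.+ (b ℤ.+ c)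
𝒢-suc j n refl refl refl =
  cong₂ ℤ._+_ (x*f-suc (ℰ j [x^ 2 ]) n)
    (trans ([x*x+1]*f (ℰ j [x^ 4 ]) (suc n))
           (cong (λ i → i ℤ.+ (ℰ j [x^ 4 ]) (suc n)) (x*f-suc (x *ₛ (ℰ j [x^ 4 ])) n)))

n*4≡n*2*2 : ∀ n → n ℕ.* 4 ≡ n ℕ.* 2 ℕ.* 2
n*4≡n*2*2 n = sym (ℕ.*-assoc n 2 2)

ℰ-suc : ∀ k n {m} → e (suc n) ≡ m → (x *ₛ ℰ k) (2 ℕ.+ n) ≡ + (m ^ k)
ℰ-suc k n refl = x*f-suc (ℰ k) (suc n)

ℰ[x^2]-odd : ∀ j n → (ℰ j [x^ 2 ]) (1 ℕ.+ n ℕ.* 4) ≡ 0ℤ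
ℰ[x^2]-odd j n = trans (cong (λ i → (ℰ j [x^ 2 ]) (1 ℕ.+ i)) (n*4≡n*2*2 n))
                       (dilate-nonmultiple (ℰ j) 2 (n ℕ.* 2) 1 (ℕ.n<1+n 1))

x*ℰ[x^4] : ∀ j n r .{{_ : ℕ.NonZero r}} → r < 4 → (x *ₛ (ℰ j [x^ 4 ])) (1 ℕ.+ (r ℕ.+ n ℕ.* 4)) ≡ 0ℤ
x*ℰ[x^4] j n r r<4 = trans (x*f-suc (ℰ j [x^ 4 ]) (r ℕ.+ n ℕ.* 4)) (dilate-nonmultiple (ℰ j) 4 n r r<4)

-- The exponent `suc k` in `VanishingAt` matters at index 2, where `x *ₛ ℰ k` has coefficient
-- `e 1 ^ k`, that is `0 ^ k`, which is 1 for `k = 0`.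
VanishingAt PowersAt : ℕ → Set
VanishingAt n = (∀ j → 𝒢 j n ≡ 0ℤ) × (∀ k → (x *ₛ ℰ (suc k)) n ≡ 0ℤ)
PowersAt n = ∃[ a ] (∀ j → 𝒢 j n ≡ + (a ^ j)) × (∀ k → (x *ₛ ℰ k) n ≡ + (suc a ^ k))

-- Apart from small indices, coefficient `suc n` of `x *ₛ ℰ k` is `e n ^ k`. The residue of `n`
-- modulo 4 selects both the degree formula for `e n` and the only dilated series that contributes
-- to `𝒢 j`.
vanishing⊎powers : ∀ n → VanishingAt n ⊎ PowersAt n
vanishing⊎powers zero = inj₁ ((λ j → refl) , λ k → refl)
vanishing⊎powers (suc n) with n divMod 4
... | result zero zero refl = inj₁ ((λ j → refl) , λ k → refl)
-- For even `n` the witness is `e` at half of `n`, supplied by the series in `x²`.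
... | result (suc q) zero refl = inj₂ (e (suc q ℕ.* 2) ,
  (λ j → trans (𝒢-suc j (suc q ℕ.* 4)
            (trans (cong (ℰ j [x^ 2 ]) (n*4≡n*2*2 (suc q))) (dilate-multiple (ℰ j) 2 (suc q ℕ.* 2)))
            -- `suc q ℕ.* 4` is `1 ℕ.+ (3 ℕ.+ q ℕ.* 4)`, so the shift by `x` lands on residue 3.
            (x*ℰ[x^4] j q 3 (ℕ.n<1+n 3))
            (dilate-nonmultiple (ℰ j) 4 (suc q) 1 (s≤s (s≤s z≤n))))
          (ℤ.+-identityʳ (+ (e (suc q ℕ.* 2) ^ j)))) ,
  λ k → ℰ-suc k (3 ℕ.+ q ℕ.* 4) (trans (cong e (n*4≡n*2*2 (suc q))) (e[n*2]≡1+e[n] (suc q ℕ.* 2))))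
-- Index 2: here `e 1` is 0, so its positive powers vanish.
... | result zero (suc zero) refl = inj₁ ((λ j → refl) , λ k → refl)
-- For `n` of the form 4m+1 the series in `x⁴` contributes through its shift by `x *ₛ x`, and `e n`
-- is `1 + e m`.
... | result (suc q) (suc zero) refl = inj₂ (e (suc q) ,
  (λ j → trans (𝒢-suc j (1 ℕ.+ suc q ℕ.* 4)
            (ℰ[x^2]-odd j (suc q))
            (trans (x*f-suc (ℰ j [x^ 4 ]) (suc q ℕ.* 4)) (dilate-multiple (ℰ j) 4 (suc q)))
            (dilate-nonmultiple (ℰ j) 4 (suc q) 2 (s≤s (s≤s (s≤s z≤n)))))
          (trans (ℤ.+-identityˡ _) (ℤ.+-identityʳ (+ (e (suc q) ^ j))))) ,
  λ k → ℰ-suc k (suc q ℕ.* 4) (e[1+n*4]≡1+e[n] (suc q)))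
... | result q (suc (suc zero)) refl = inj₂ (e (1 ℕ.+ q ℕ.* 2) ,
  (λ j → trans (𝒢-suc j (2 ℕ.+ q ℕ.* 4)
            (trans (cong (λ i → (ℰ j [x^ 2 ]) (2 ℕ.+ i)) (n*4≡n*2*2 q)) (dilate-multiple (ℰ j) 2 (1 ℕ.+ q ℕ.* 2)))
            (x*ℰ[x^4] j q 1 (s≤s (s≤s z≤n)))
            (dilate-nonmultiple (ℰ j) 4 q 3 (ℕ.n<1+n 3)))
          (ℤ.+-identityʳ (+ (e (1 ℕ.+ q ℕ.* 2) ^ j)))) ,
  λ k → ℰ-suc k (1 ℕ.+ q ℕ.* 4) (trans (cong (λ i → e (2 ℕ.+ i)) (n*4≡n*2*2 q)) (e[n*2]≡1+e[n] (1 ℕ.+ q ℕ.* 2))))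
-- For `n` of the form 4q+3 the unshifted series in `x⁴` contributes, at index 4(q+1).
... | result q (suc (suc (suc zero))) refl = inj₂ (e (suc q) ,
  (λ j → trans (𝒢-suc j (3 ℕ.+ q ℕ.* 4)
            (trans (cong (λ i → (ℰ j [x^ 2 ]) (3 ℕ.+ i)) (n*4≡n*2*2 q))
                   (dilate-nonmultiple (ℰ j) 2 (1 ℕ.+ q ℕ.* 2) 1 (ℕ.n<1+n 1)))
            (x*ℰ[x^4] j q 2 (s≤s (s≤s (s≤s z≤n))))
            (dilate-multiple (ℰ j) 4 (suc q)))
          (trans (ℤ.+-identityˡ _) (ℤ.+-identityˡ (+ (e (suc q) ^ j))))) ,
  λ k → ℰ-suc k (2 ℕ.+ q ℕ.* 4) (e[3+n*4]≡1+e[1+n] q))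

-- The binomial theorem for the coefficients

module ℤ^ = Exp ℤ.+-*-semiring
module ℤ× = Mult ℤ.+-*-semiring

pos-^ : ∀ a k → (+ a) ℤ^.^ k ≡ + (a ^ k)
pos-^ a zero    = refl
pos-^ a (suc k) = trans (cong (+ a ℤ.*_) (pos-^ a k)) (sym (ℤ.pos-* a (a ^ k)))

×≡* : ∀ n i → n ℤ×.× i ≡ + n ℤ.* i
×≡* zero    i = refl
×≡* (suc n) i = trans (cong (λ j → i ℤ.+ j) (×≡* n i)) (sym (ℤ.suc-* (+ n) i))

-- The term with exponent `k` is split off because the sum in the functional equation stops at
-- `k - 1`.
binomial-[1+a]^k : ∀ a k → + (suc a ^ k) ≡ sum {k} (λ j → + (k C toℕ j) ℤ.* + (a ^ toℕ j)) ℤ.+ + (a ^ k)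
binomial-[1+a]^k a k = begin
  + (suc a ^ k)                      ≡⟨ cong (λ b → + (b ^ k)) (ℕ.+-comm 1 a) ⟩
  + ((a ℕ.+ 1) ^ k)                  ≡⟨ pos-^ (a ℕ.+ 1) k ⟨
  (+ a ℤ.+ 1ℤ) ℤ^.^ k                ≡⟨ theorem k (+ a) 1ℤ ⟩
  binomialExpansion (+ a) 1ℤ k       ≡⟨ sum-cong-≗ {suc k} term-≡ ⟩
  sum {suc k} (term ∘ toℕ)           ≡⟨ sum-init-last {k} (term ∘ toℕ) ⟩
  sum {k} (λ j → term (toℕ (inject₁ j))) ℤ.+ term (toℕ (fromℕ k))
    ≡⟨ cong₂ ℤ._+_ (sum-cong-≗ {k} (cong term ∘ toℕ-inject₁)) (cong term (toℕ-fromℕ k)) ⟩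
  sum {k} (term ∘ toℕ) ℤ.+ term k    ≡⟨ cong (λ i → sum {k} (term ∘ toℕ) ℤ.+ + i ℤ.* + (a ^ k)) (nCn≡1 k) ⟩
  sum {k} (term ∘ toℕ) ℤ.+ 1ℤ ℤ.* + (a ^ k)
    ≡⟨ cong (λ i → sum {k} (term ∘ toℕ) ℤ.+ i) (ℤ.*-identityˡ (+ (a ^ k))) ⟩
  sum {k} (term ∘ toℕ) ℤ.+ + (a ^ k) ∎
  where
  open ≡-Reasoning
  open BinomialTheorem ℤ.+-*-commutativeSemiring using (theorem; binomialExpansion; binomialTerm)
  term : ℕ → ℤ
  term j = + (k C j) ℤ.* + (a ^ j)

  1^m≡1 : ∀ m → 1ℤ ℤ^.^ m ≡ 1ℤ
  1^m≡1 m = trans (pos-^ 1 m) (cong +_ (ℕ.^-zeroˡ m))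

  term-≡ : ∀ (j : Fin (suc k)) → binomialTerm (+ a) 1ℤ k j ≡ term (toℕ j)
  term-≡ j = trans (×≡* (k C toℕ j) _) (cong (λ i → + (k C toℕ j) ℤ.* i)
    (trans (cong₂ ℤ._*_ (pos-^ a (toℕ j)) (1^m≡1 (k ∸ toℕ j))) (ℤ.*-identityʳ _)))

i-j-k≡i-[j+k] : ∀ i j k → i ℤ.- j ℤ.- k ≡ i ℤ.- (j ℤ.+ k)
i-j-k≡i-[j+k] i j k = trans (ℤ.+-assoc i (ℤ.- j) (ℤ.- k)) (cong (λ m → i ℤ.+ m) (sym (ℤ.neg-distrib-+ j k)))

-- Where the coefficients are powers, the subtracted `𝒢 k` is exactly the top term of the binomial
-- expansion; elsewhere both sides are 0.
functional-equation : ∀ k → 1 ≤ k → ∀ n →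
  (x *ₛ ℰ k) n ℤ.- 𝒢 k n ≡ sum {k} (λ j → + (k C toℕ j) ℤ.* 𝒢 (toℕ j) n)
functional-equation k@(suc k-1) _ n with vanishing⊎powers n
... | inj₁ (𝒢≡0 , xℰ≡0) = begin
  (x *ₛ ℰ k) n ℤ.- 𝒢 k n                        ≡⟨ cong₂ ℤ._-_ (xℰ≡0 k-1) (𝒢≡0 k) ⟩
  0ℤ                                            ≡⟨ sum-replicate-zero k ⟨
  sum {k} (λ _ → 0ℤ)                            ≡⟨ sum-cong-≗ {k} (λ j → term≡0 (toℕ j)) ⟨
  sum {k} (λ j → + (k C toℕ j) ℤ.* 𝒢 (toℕ j) n) ∎
  where
  open ≡-Reasoning
  term≡0 : ∀ j → + (k C j) ℤ.* 𝒢 j n ≡ 0ℤ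
  term≡0 j = trans (cong (+ (k C j) ℤ.*_) (𝒢≡0 j)) (ℤ.*-zeroʳ (+ (k C j)))
... | inj₂ (a , 𝒢≡a^ , xℰ≡) = begin
  (x *ₛ ℰ k) n ℤ.- 𝒢 k n                          ≡⟨ cong₂ ℤ._-_ (trans (xℰ≡ k) (binomial-[1+a]^k a k)) (𝒢≡a^ k) ⟩
  s ℤ.+ + (a ^ k) ℤ.- + (a ^ k)                   ≡⟨ ℤ.+-assoc s _ _ ⟩
  s ℤ.+ (+ (a ^ k) ℤ.- + (a ^ k))                 ≡⟨ cong (λ i → s ℤ.+ i) (ℤ.+-inverseʳ (+ (a ^ k))) ⟩
  s ℤ.+ 0ℤ                                        ≡⟨ ℤ.+-identityʳ s ⟩
  s                                               ≡⟨ sum-cong-≗ {k} (λ j → cong (+ (k C toℕ j) ℤ.*_) (𝒢≡a^ (toℕ j))) ⟨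
  sum {k} (λ j → + (k C toℕ j) ℤ.* 𝒢 (toℕ j) n)   ∎
  where
  open ≡-Reasoning
  s : ℤ
  s = sum {k} (λ j → + (k C toℕ j) ℤ.* + (a ^ toℕ j))

-- The geometric series and the assembly of the identity

ℰ₀*[1-x]≈x : ℰ 0 *ₛ (1ₛ -ₛ x) ≈ₛ x *ₛ 1ₛ
ℰ₀*[1-x]≈x = begin
  ℰ 0 *ₛ (1ₛ -ₛ x)       ≈⟨ *ₛ-comm (ℰ 0) (1ₛ -ₛ x) ⟩
  (1ₛ -ₛ x) *ₛ ℰ 0       ≈⟨ *ₛ-distribʳ--ₛ (ℰ 0) 1ₛ x ⟩
  1ₛ *ₛ ℰ 0 -ₛ x *ₛ ℰ 0  ≈⟨ shift ⟩
  x                      ≈⟨ PS.*-identityʳ x ⟨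
  x *ₛ 1ₛ                ∎
  where
  open SetoidReasoning PS.setoid
  shift : 1ₛ *ₛ ℰ 0 -ₛ x *ₛ ℰ 0 ≈ₛ x
  shift zero          = refl
  shift (suc zero)    = refl
  -- From index 2 on, both coefficients of `ℰ 0` are 1 and the difference telescopes to 0.
  shift (suc (suc n)) = cong₂ ℤ._-_ (*ₛ-identityˡ (ℰ 0) (2 ℕ.+ n)) (x*f-suc (ℰ 0) (suc n))

mainTheorem19 : (ι (ℰ 0) ≃ x ÷ (1ₛ -ₛ x))
    ×
    (∀ (k : ℕ) → 1 ≤ k →
    ι (ℰ k) - ι (ℰ k [x^ 2 ]) - ((x *ₛ x +ₛ 1ₛ) ÷ x) * ι (ℰ k [x^ 4 ])
    ≃ ∑[ j < k ] (ι (const (+ (k C j))) * (ι (ℰ j [x^ 2 ]) + ((x *ₛ x +ₛ 1ₛ) ÷ x) * ι (ℰ j [x^ 4 ]))))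
-- Both sides of the functional equation are written over the denominator `x`; `÷x-unique` then
-- reduces it to an equality of numerators.
mainTheorem19 = ℰ₀*[1-x]≈x , λ k 1≤k → ÷x-unique
  (÷x-cong (lhs-coefficient k 1≤k)
    (÷x-- (÷x-- (÷x-ι (ℰ k)) (÷x-ι (ℰ k [x^ 2 ]))) (÷x-*ι (x *ₛ x +ₛ 1ₛ) (ℰ k [x^ 4 ]))))
  (÷x-∑ k _ (λ j → const (+ (k C j)) *ₛ 𝒢 j) λ j →
    ÷x-ι* (const (+ (k C j))) (÷x-+ (÷x-ι (ℰ j [x^ 2 ])) (÷x-*ι (x *ₛ x +ₛ 1ₛ) (ℰ j [x^ 4 ]))))
  where
  lhs-coefficient : ∀ k → 1 ≤ k →
    x *ₛ ℰ k -ₛ x *ₛ (ℰ k [x^ 2 ]) -ₛ (x *ₛ x +ₛ 1ₛ) *ₛ (ℰ k [x^ 4 ])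
      ≈ₛ (λ n → sum {k} (λ j → (const (+ (k C toℕ j)) *ₛ 𝒢 (toℕ j)) n))
  lhs-coefficient k 1≤k n = begin
    (x *ₛ ℰ k -ₛ x *ₛ (ℰ k [x^ 2 ]) -ₛ (x *ₛ x +ₛ 1ₛ) *ₛ (ℰ k [x^ 4 ])) n
      ≡⟨ i-j-k≡i-[j+k] ((x *ₛ ℰ k) n) _ _ ⟩
    (x *ₛ ℰ k) n ℤ.- 𝒢 k n
      ≡⟨ functional-equation k 1≤k n ⟩
    sum {k} (λ j → + (k C toℕ j) ℤ.* 𝒢 (toℕ j) n)
      ≡⟨ sum-cong-≗ {k} (λ j → const-* (+ (k C toℕ j)) (𝒢 (toℕ j)) n) ⟨
    sum {k} (λ j → (const (+ (k C toℕ j)) *ₛ 𝒢 (toℕ j)) n)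
      ∎
    where open ≡-Reasoning
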